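{- Let $q$ be a prime and let $f(x), g(x) \in \mathbb{Z}[x]$ be polynomials that are not identically zero in $\mathbb{Z}_q$ (i.e., each has at least one coefficient not divisible by $q$). If the system of congruences $f(x) \equiv 0 \pmod{q}$, $g(x) \equiv 0 \pmod{q}$ has $\ell$ solutions (residues $x \in \mathbb{Z}_q$), then $R(f(x), g(x)) \equiv 0 \pmod{q^\ell}$.
   Context: For $f(x)=\sum_{i=0}^n a_i x^i$ and $g(x)=\sum_{j=0}^m b_j x^j$ with $a_n\neq 0$, $b_m\neq 0$ (degrees $n$ and $m$ over $\mathbb{Z}$), the resultant $R(f,g)$ is the determinant of the Sylvester matrix of $f$ and $g$; equivalently $R(f,g)=a_n^m b_m^n\prod_{i=1}^n\prod_{j=1}^m(\alpha_i-\beta_j)=a_n^m\prod_{i=1}^n g(\alpha_i)$, where $\alpha_i$ and $\beta_j$ are the complex roots of $f$ and $g$, repeated according to multiplicity. $\mathbb{Z}_q$ denotes the integers modulo $q$. -}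

module Defs where

open import Data.Nat as ℕ using (ℕ; zero; suc; _<?_; _≤?_)
open import Data.Nat.Divisibility as ℕD using ()
open import Data.Integer as ℤ using (ℤ; +_; -_; _*_; _+_; _^_; ∣_∣)
open import Data.Fin using (Fin; zero; suc; toℕ; fromℕ<; punchIn)
open import Data.List using (List; length; filter; upTo)
open import Data.Product using (_×_)
open import Relation.Nullary.Decidable using (yes; no; _×-dec_; ⌊_⌋)
open import Data.Bool using (if_then_else_; _∧_)

-- A polynomial over ℤ of degree exactly n is given by its coefficient
-- function a : Fin (suc n) → ℤ (a i = coefficient of x^i) together with
-- the hypothesis a n ≢ 0 (stated in the theorem).

Σ : (k : ℕ) → (Fin k → ℤ) → ℤ
Σ zero    f = + 0
Σ (suc k) f = f zero + Σ k (λ i → f (suc i))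

eval : (n : ℕ) → (Fin (suc n) → ℤ) → ℤ → ℤ
eval n a x = Σ (suc n) (λ i → a i * (x ^ toℕ i))

coef : (n : ℕ) → (Fin (suc n) → ℤ) → ℕ → ℤ
coef n a k with k <? suc n
... | yes p = a (fromℕ< p)
... | no  _ = + 0

det : (k : ℕ) → (Fin k → Fin k → ℤ) → ℤ
det zero    M = + 1
det (suc k) M = Σ (suc k) (λ j → sgn (toℕ j) * (M zero j * det k (λ r c → M (suc r) (punchIn j c))))
  where
  sgn : ℕ → ℤ
  sgn zero          = + 1
  sgn (suc zero)    = - (+ 1)
  sgn (suc (suc t)) = sgn t

-- entry of a shifted coefficient row: row i (0-based) contains
-- a_n, a_{n-1}, …, a_0 starting at column i, zeros elsewhere
shiftRow : (n : ℕ) → (Fin (suc n) → ℤ) → ℕ → ℕ → ℤ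
shiftRow n a i c =
  if ⌊ i ≤? c ⌋ ∧ ⌊ c ℕ.∸ i ≤? n ⌋ then coef n a (n ℕ.∸ (c ℕ.∸ i)) else + 0

sylvester : (n : ℕ) → (Fin (suc n) → ℤ) → (m : ℕ) → (Fin (suc m) → ℤ)
          → Fin (n ℕ.+ m) → Fin (n ℕ.+ m) → ℤ
sylvester n a m b r c with toℕ r <? m
... | yes _ = shiftRow n a (toℕ r) (toℕ c)
... | no  _ = shiftRow m b (toℕ r ℕ.∸ m) (toℕ c)

resultant : (n : ℕ) → (Fin (suc n) → ℤ) → (m : ℕ) → (Fin (suc m) → ℤ) → ℤ
resultant n a m b = det (n ℕ.+ m) (sylvester n a m b)

commonRootCount : (q : ℕ) → (n : ℕ) → (Fin (suc n) → ℤ) → (m : ℕ) → (Fin (suc m) → ℤ) → ℕ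
commonRootCount q n a m b =
  length (filter (λ x → (q ℕD.∣? ∣ eval n a (+ x) ∣) ×-dec (q ℕD.∣? ∣ eval m b (+ x) ∣)) (upTo q))

{-# OPTIONS --safe #-}
-- Read the rows of the Sylvester matrix as polynomials of degree < n + m: they
-- are x^i f and x^j g, so they all vanish mod q at a common root x₁. Synthetic
-- division by x - x₁ is a sequence of additions of multiples of a column to the
-- next one, which preserves the determinant; it leaves the quotients in all
-- columns but the last, and the values at x₁ in the last, from which a factor
-- q comes out. The quotients still vanish mod q at the other common roots, so
-- the division can be repeated on the remaining columns. There are enough
-- columns because f, being nonzero mod q, has at most n roots mod q.
module Submission where

open import Defs
open import Data.Bool using (if_then_else_)
open import Data.Nat as ℕ using (ℕ; zero; suc; _^_; s≤s)
import Data.Nat.Divisibility as ℕD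
import Data.Nat.Properties as ℕP
open import Data.Nat.Primality using (Prime; euclidsLemma)
open import Data.Integer as ℤ using (ℤ; +_; -_; _+_; _*_; _-_; ∣_∣)
open import Data.Integer.Divisibility using (_∣_)
import Data.Integer.Divisibility.Signed as ℤS
import Data.Integer.Properties as ℤP
open import Data.Integer.Tactic.RingSolver using (solve-∀)
open import Data.Fin using (Fin; zero; suc; toℕ; fromℕ; fromℕ<; inject₁; punchIn; punchOut; _≟_)
open import Data.Fin.Properties
  using (punchIn-punchOut; punchIn-injective; punchInᵢ≢i; suc-injective; toℕ-inject₁;
         toℕ-injective; toℕ-fromℕ<; fromℕ<-toℕ; toℕ<n; toℕ≤pred[n])
open import Data.List using (List; []; _∷_; length; map; filter; upTo)
open import Data.List.Properties using (length-map)
open import Data.List.Relation.Unary.All as All using (All; []; _∷_)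
import Data.List.Relation.Unary.All.Properties as AllP
open import Data.List.Relation.Unary.AllPairs using (AllPairs; []; _∷_)
import Data.List.Relation.Unary.AllPairs.Properties as AllPairsP
open import Data.Product using (∃; _×_; _,_)
open import Data.Sum using (inj₁; inj₂)
open import Function using (_∘_)
open import Relation.Binary.PropositionalEquality
  using (_≡_; _≢_; refl; sym; trans; cong; cong₂; subst; subst₂; module ≡-Reasoning)
open import Relation.Nullary using (¬_; yes; no; does; contradiction)
open import Relation.Nullary.Decidable using (dec-true; dec-false; _×-dec_)

-- Finite sums and linearity of the determinant

Matrix : ℕ → Set
Matrix k = Fin k → Fin k → ℤ

Σ-cong : ∀ {k} {f g : Fin k → ℤ} → (∀ i → f i ≡ g i) → Σ k f ≡ Σ k g
Σ-cong {zero}  f≗g = refl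
Σ-cong {suc k} f≗g = cong₂ _+_ (f≗g zero) (Σ-cong (f≗g ∘ suc))

Σ-linear : ∀ {k} (s t : ℤ) (f g : Fin k → ℤ) →
           Σ k (λ i → s * f i + t * g i) ≡ s * Σ k f + t * Σ k g
Σ-linear {zero}  s t f g = lemma s t
  where
  lemma : ∀ s t → + 0 ≡ s * + 0 + t * + 0
  lemma = solve-∀
Σ-linear {suc k} s t f g =
  trans (cong (λ z → s * f zero + t * g zero + z) (Σ-linear s t (f ∘ suc) (g ∘ suc)))
        (lemma s t (f zero) (g zero) _ _)
  where
  lemma : ∀ s t a b x y → s * a + t * b + (s * x + t * y) ≡ s * (a + x) + t * (b + y)
  lemma = solve-∀

-- Serves to compare two expansions along the first row in which only the sum of two adjacent terms
-- is preserved.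
Σ-cong-except-pair : ∀ {k} (j : Fin k) {f g : Fin (suc k) → ℤ} →
  (∀ p → p ≢ inject₁ j → p ≢ suc j → f p ≡ g p) →
  f (inject₁ j) + f (suc j) ≡ g (inject₁ j) + g (suc j) →
  Σ (suc k) f ≡ Σ (suc k) g
Σ-cong-except-pair zero {f} {g} rest pair =
  trans (sym (ℤP.+-assoc (f zero) _ _))
    (trans (cong₂ _+_ pair (Σ-cong (λ i → rest (suc (suc i)) (λ ()) (λ ()))))
           (ℤP.+-assoc (g zero) _ _))
Σ-cong-except-pair (suc j) rest pair =
  cong₂ _+_ (rest zero (λ ()) (λ ()))
    (Σ-cong-except-pair j
      (λ p p≢j p≢1+j → rest (suc p) (p≢j ∘ suc-injective) (p≢1+j ∘ suc-injective)) pair)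

-- Negating at every step makes the signs of adjacent columns opposite by definition, unlike the
-- two-step recursion inside `det`.
sign : ℕ → ℤ
sign zero    = + 1
sign (suc t) = - sign t

minor : ∀ {k} → Matrix (suc k) → Fin (suc k) → Matrix k
minor M p r c = M (suc r) (punchIn p c)

-- The sign function local to det cannot be named from outside; the two
-- underscores below are solved to expressions mentioning it.
mutual
  det-expand : ∀ k (M : Matrix (suc k)) →
    det (suc k) M ≡ Σ (suc k) (λ j → sign (toℕ j) * (M zero j * det k (minor M j)))
  det-expand k M =
    cong (λ z → + 1 * (M zero zero * det k (minor M zero)) + z) (Σ-cong {k} (det-term k M))

  det-term : ∀ k (M : Matrix (suc k)) (i : Fin k) →
    _ ≡ sign (suc (toℕ i)) * (M zero (suc i) * det k (minor M (suc i)))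
  det-term k M i with toℕ i
  ... | t = det-term-at k M i t

  det-term-at : ∀ k (M : Matrix (suc k)) (i : Fin k) (t : ℕ) →
    _ ≡ sign (suc t) * (M zero (suc i) * det k (minor M (suc i)))
  det-term-at k M i zero          = refl
  det-term-at k M i (suc zero)    = refl
  det-term-at k M i (suc (suc t)) = trans (det-term-at k M i t)
    (cong (_* (M zero (suc i) * det k (minor M (suc i)))) (sym (ℤP.neg-involutive (sign (suc t)))))

det-cong : ∀ {k} {A B : Matrix k} → (∀ r c → A r c ≡ B r c) → det k A ≡ det k B
det-cong {zero}          A≗B = refl
det-cong {suc k} {A} {B} A≗B =
  trans (det-expand k A) (trans (Σ-cong term) (sym (det-expand k B)))
  where
  term : ∀ j → sign (toℕ j) * (A zero j * det k (minor A j))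
             ≡ sign (toℕ j) * (B zero j * det k (minor B j))
  term j = cong (sign (toℕ j) *_)
    (cong₂ _*_ (A≗B zero j) (det-cong (λ r c → A≗B (suc r) (punchIn j c))))

-- Induction along the first row. The term at `p = j` is linear in its entry, and its minor omits
-- column `j`; every other term shares its entry, and its minor is linear in column `punchOut p≢j`.
det-linear : ∀ {k} (j : Fin k) (s t : ℤ) {A B C : Matrix k} →
  (∀ r c → c ≢ j → C r c ≡ A r c) → (∀ r c → c ≢ j → C r c ≡ B r c) →
  (∀ r → C r j ≡ s * A r j + t * B r j) →
  det k C ≡ s * det k A + t * det k B
det-linear {suc k} j s t {A} {B} {C} C≗A C≗B Cj =
  trans (det-expand k C)
    (trans (Σ-cong term)
      (trans (Σ-linear s t (summand A) (summand B))
        (sym (cong₂ (λ x y → s * x + t * y) (det-expand k A) (det-expand k B)))))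
  where
  at : ∀ σ s t a b d → σ * ((s * a + t * b) * d) ≡ s * (σ * (a * d)) + t * (σ * (b * d))
  at = solve-∀

  off : ∀ σ s t c x y → σ * (c * (s * x + t * y)) ≡ s * (σ * (c * x)) + t * (σ * (c * y))
  off = solve-∀

  summand : Matrix (suc k) → Fin (suc k) → ℤ
  summand M p = sign (toℕ p) * (M zero p * det k (minor M p))

  term : ∀ p → summand C p ≡ s * summand A p + t * summand B p
  term p with p ≟ j
  ... | yes refl =
    trans (cong (λ c → sign (toℕ p) * (c * det k (minor C p))) (Cj zero))
      (trans (at (sign (toℕ p)) s t (A zero p) (B zero p) (det k (minor C p)))
        (cong₂ (λ x y → s * (sign (toℕ p) * (A zero p * x)) + t * (sign (toℕ p) * (B zero p * y)))
          (det-cong (λ r c → C≗A (suc r) (punchIn p c) (punchInᵢ≢i p c)))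
          (det-cong (λ r c → C≗B (suc r) (punchIn p c) (punchInᵢ≢i p c)))))
  ... | no p≢j =
    trans (cong (λ d → sign (toℕ p) * (C zero p * d)) minor-linear)
      (trans (off (sign (toℕ p)) s t (C zero p) (det k (minor A p)) (det k (minor B p)))
        (cong₂ (λ x y → s * (sign (toℕ p) * (x * det k (minor A p)))
                      + t * (sign (toℕ p) * (y * det k (minor B p))))
          (C≗A zero p p≢j) (C≗B zero p p≢j)))
    where
    j′ : Fin k
    j′ = punchOut p≢j

    avoids : ∀ c → c ≢ j′ → punchIn p c ≢ j
    avoids c c≢j′ eq =
      c≢j′ (punchIn-injective p c j′ (trans eq (sym (punchIn-punchOut p≢j))))

    minor-linear : det k (minor C p) ≡ s * det k (minor A p) + t * det k (minor B p)
    minor-linear = det-linear j′ s t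
      (λ r c c≢j′ → C≗A (suc r) (punchIn p c) (avoids c c≢j′))
      (λ r c c≢j′ → C≗B (suc r) (punchIn p c) (avoids c c≢j′))
      (λ r → subst (λ c → C (suc r) c ≡ s * A (suc r) c + t * B (suc r) c)
                   (sym (punchIn-punchOut p≢j)) (Cj (suc r)))

det-scale : ∀ {k} (j : Fin k) (s : ℤ) {A C : Matrix k} →
  (∀ r c → c ≢ j → C r c ≡ A r c) → (∀ r → C r j ≡ s * A r j) →
  det k C ≡ s * det k A
det-scale j s {A} C≗A Cj =
  -- The second coefficient is zero, with `A` itself as the second matrix.
  trans (det-linear j s (+ 0) C≗A C≗A (λ r → trans (Cj r) (sym (lemma s (A r j)))))
        (lemma s _)
  where
  lemma : ∀ s a → s * a + + 0 * a ≡ s * a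
  lemma = solve-∀

-- Adding a multiple of a column to the next one

-- Lets the induction in `det-addColumn` pass to minors: deleting a third column keeps an adjacent
-- pair adjacent.
punchIn-adjacent : ∀ {k} (p : Fin (suc (suc k))) (j : Fin (suc k)) →
  p ≢ inject₁ j → p ≢ suc j →
  ∃ λ j′ → punchIn p (inject₁ j′) ≡ inject₁ j × punchIn p (suc j′) ≡ suc j
punchIn-adjacent zero zero p≢j _ = contradiction refl p≢j
punchIn-adjacent zero (suc j) _ _ = j , refl , refl
punchIn-adjacent (suc zero) zero _ p≢1 = contradiction refl p≢1
punchIn-adjacent {suc k} (suc (suc p)) zero _ _ = zero , refl , refl
punchIn-adjacent {suc k} (suc p) (suc j) p≢j p≢1+j
  with j′ , eq , eq₁ ← punchIn-adjacent p j (p≢j ∘ cong suc) (p≢1+j ∘ cong suc)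
  = suc j′ , cong suc eq , cong suc eq₁

punchIn-inject₁-same : ∀ {k} (j : Fin k) → punchIn (inject₁ j) j ≡ suc j
punchIn-inject₁-same zero    = refl
punchIn-inject₁-same (suc j) = cong suc (punchIn-inject₁-same j)

punchIn-suc-same : ∀ {k} (j : Fin k) → punchIn (suc j) j ≡ inject₁ j
punchIn-suc-same zero    = refl
punchIn-suc-same (suc j) = cong suc (punchIn-suc-same j)

-- With the two lemmas before: the minors omitting one or the other column of an adjacent pair
-- differ only in column `j`, where each shows the column that the other omits.
punchIn-inject₁-suc : ∀ {k} (j c : Fin k) → c ≢ j → punchIn (inject₁ j) c ≡ punchIn (suc j) c
punchIn-inject₁-suc zero    zero    c≢j = contradiction refl c≢j
punchIn-inject₁-suc zero    (suc c) c≢j = refl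
punchIn-inject₁-suc (suc j) zero    c≢j = refl
punchIn-inject₁-suc (suc j) (suc c) c≢j = cong suc (punchIn-inject₁-suc j c (c≢j ∘ cong suc))

inject₁≢suc : ∀ {k} (j : Fin k) → inject₁ j ≢ suc j
inject₁≢suc (suc j) eq = inject₁≢suc j (suc-injective eq)

-- Restricting to adjacent columns makes the two exceptional minors in the
-- expansion differ in a single column, so linearity alone suffices.
det-addColumn : ∀ {k} (j : Fin k) (t : ℤ) {A B : Matrix (suc k)} →
  (∀ r c → c ≢ suc j → B r c ≡ A r c) →
  (∀ r → B r (suc j) ≡ A r (suc j) + t * A r (inject₁ j)) →
  det (suc k) B ≡ det (suc k) A
det-addColumn {suc k} j t {A} {B} B≗A Bj =
  trans (det-expand (suc k) B)
    (trans (Σ-cong-except-pair j other pair) (sym (det-expand (suc k) A)))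
  where
  term : Matrix (suc (suc k)) → Fin (suc (suc k)) → ℤ
  term M p = sign (toℕ p) * (M zero p * det (suc k) (minor M p))

  other : ∀ p → p ≢ inject₁ j → p ≢ suc j → term B p ≡ term A p
  other p p≢j p≢1+j with j′ , eq , eq₁ ← punchIn-adjacent p j p≢j p≢1+j =
    cong (sign (toℕ p) *_) (cong₂ _*_ (B≗A zero p p≢1+j)
      (det-addColumn j′ t
        (λ r c c≢ → B≗A (suc r) (punchIn p c)
           (λ e → c≢ (punchIn-injective p c (suc j′) (trans e (sym eq₁)))))
        (λ r → trans (cong (B (suc r)) eq₁) (trans (Bj (suc r))
           (cong₂ (λ x y → A (suc r) x + t * A (suc r) y) (sym eq₁) (sym eq))))))

  -- This minor keeps the altered column, at position `j`. The multiple of column `inject₁ j` added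
  -- there yields the minor of `A` that omits `suc j`.
  minor-at-j : det (suc k) (minor B (inject₁ j))
             ≡ + 1 * det (suc k) (minor A (inject₁ j)) + t * det (suc k) (minor A (suc j))
  minor-at-j = det-linear j (+ 1) t agree
    (λ r c c≢j → trans (agree r c c≢j) (cong (A (suc r)) (punchIn-inject₁-suc j c c≢j)))
    (λ r → trans (cong (B (suc r)) (punchIn-inject₁-same j)) (trans (Bj (suc r))
       (cong₂ (λ x y → x + t * y)
         (sym (trans (ℤP.*-identityˡ _) (cong (A (suc r)) (punchIn-inject₁-same j))))
         (cong (A (suc r)) (sym (punchIn-suc-same j))))))
    where
    agree : ∀ r c → c ≢ j → minor B (inject₁ j) r c ≡ minor A (inject₁ j) r c
    agree r c c≢j = B≗A (suc r) _
      (λ e → c≢j (punchIn-injective (inject₁ j) c j (trans e (sym (punchIn-inject₁-same j)))))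

  minor-at-1+j : det (suc k) (minor B (suc j)) ≡ det (suc k) (minor A (suc j))
  minor-at-1+j = det-cong (λ r c → B≗A (suc r) _ (punchInᵢ≢i (suc j) c))

  -- With `x` and `y` the two minors of `A`, the extra products `t * a * y` cancel because the signs
  -- are opposite.
  cancel : ∀ σ t a b x y →
    σ * (a * (+ 1 * x + t * y)) + (- σ) * ((b + t * a) * y) ≡ σ * (a * x) + (- σ) * (b * y)
  cancel = solve-∀

  sign-inject₁ : sign (toℕ (inject₁ j)) ≡ sign (toℕ j)
  sign-inject₁ = cong sign (toℕ-inject₁ j)

  pair : term B (inject₁ j) + term B (suc j) ≡ term A (inject₁ j) + term A (suc j)
  pair = trans
    (cong₂ _+_
      (cong₂ _*_ sign-inject₁ (cong₂ _*_ (B≗A zero _ (inject₁≢suc j)) minor-at-j))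
      (cong (sign (suc (toℕ j)) *_) (cong₂ _*_ (Bj zero) minor-at-1+j)))
    (trans (cancel (sign (toℕ j)) t (A zero (inject₁ j)) (A zero (suc j)) _ _)
      (cong (_+ term A (suc j))
        (cong (_* (A zero (inject₁ j) * det (suc k) (minor A (inject₁ j)))) (sym sign-inject₁))))

-- Horner's scheme and synthetic division

-- horner s x k is the value at x of the polynomial whose coefficients, from
-- the leading one down, are s 0, …, s (k - 1).
horner : (ℕ → ℤ) → ℤ → ℕ → ℤ
horner s x zero    = + 0
horner s x (suc k) = x * horner s x k + s k

-- The partial values of Horner's scheme are the coefficients of the quotient by `X - x`, leading
-- one first; the final value is the remainder.
quotient : (ℕ → ℤ) → ℤ → ℕ → ℤ
quotient s x c = horner s x (suc c)

horner-cong : ∀ {s t} x k → (∀ c → c ℕ.< k → s c ≡ t c) → horner s x k ≡ horner t x k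
horner-cong x zero    s≗t = refl
horner-cong x (suc k) s≗t =
  cong₂ (λ h a → x * h + a) (horner-cong x k (λ c c<k → s≗t c (ℕP.m<n⇒m<1+n c<k))) (s≗t k ℕP.≤-refl)

-- Division with remainder by `X - x`, evaluated at `y`.
horner-quotient : ∀ s x y k →
  horner (quotient s x) y k * (y - x) ≡ horner s y (suc k) - horner s x (suc k)
horner-quotient s x y zero = lemma x y (s 0)
  where
  lemma : ∀ x y a → + 0 * (y - x) ≡ (y * + 0 + a) - (x * + 0 + a)
  lemma = solve-∀
horner-quotient s x y (suc k) =
  trans (expand x y (horner (quotient s x) y k) hx)
    (trans (cong (λ d → y * d + hx * (y - x)) (horner-quotient s x y k))
      (collect x y hx (horner s y (suc k)) (s (suc k))))
  where
  hx : ℤ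
  hx = horner s x (suc k)

  expand : ∀ x y Q h → (y * Q + h) * (y - x) ≡ y * (Q * (y - x)) + h * (y - x)
  expand = solve-∀

  collect : ∀ x y h g a → y * (g - h) + h * (y - x) ≡ (y * g + a) - (x * h + a)
  collect = solve-∀

horner-Σ : ∀ s x k → horner s x (suc k) ≡ Σ (suc k) (λ i → s (k ℕ.∸ toℕ i) * (x ℤ.^ toℕ i))
horner-Σ s x zero = lemma x (s 0)
  where
  lemma : ∀ x a → x * + 0 + a ≡ a * + 1 + + 0
  lemma = solve-∀
horner-Σ s x (suc k) =
  trans (cong (λ h → x * h + s (suc k)) (horner-Σ s x k))
    -- The summand `+ 0 * z` only gives the expression the shape of `Σ-linear`.
    (trans (lemma x (s (suc k)) (Σ (suc k) low))
      (cong (λ z → s (suc k) * + 1 + z)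
        (trans (sym (Σ-linear x (+ 0) low low)) (Σ-cong {suc k} (λ i → shift x (s (k ℕ.∸ toℕ i)) (x ℤ.^ toℕ i))))))
  where
  low : Fin (suc k) → ℤ
  low i = s (k ℕ.∸ toℕ i) * (x ℤ.^ toℕ i)

  lemma : ∀ x a z → x * z + a ≡ a * + 1 + (x * z + + 0 * z)
  lemma = solve-∀

  shift : ∀ x a p → x * (a * p) + + 0 * (a * p) ≡ a * (x * p)
  shift = solve-∀

-- Synthetic division by column operations

-- A row midway through the division: `j` columns are done. Consecutive stages differ in one column.
partialDivision : ℕ → ℤ → (ℕ → ℤ) → ℕ → ℤ
partialDivision j x s c = if does (c ℕ.<? j) then quotient s x c else s c

partialDivision-< : ∀ {j c} x s → c ℕ.< j → partialDivision j x s c ≡ quotient s x c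
partialDivision-< {j} {c} x s c<j rewrite dec-true (c ℕ.<? j) c<j = refl

partialDivision-≮ : ∀ {j c} x s → ¬ c ℕ.< j → partialDivision j x s c ≡ s c
partialDivision-≮ {j} {c} x s c≮j rewrite dec-false (c ℕ.<? j) c≮j = refl

partialDivision-step : ∀ {j c} x s → c ≢ j → partialDivision (suc j) x s c ≡ partialDivision j x s c
partialDivision-step {j} {c} x s c≢j with c ℕ.<? j
... | yes c<j = trans (partialDivision-< x s (ℕP.m<n⇒m<1+n c<j)) (sym (partialDivision-< x s c<j))
... | no  c≮j = trans (partialDivision-≮ x s (λ c<1+j → c≮j (ℕP.≤∧≢⇒< (ℕP.≤-pred c<1+j) c≢j)))
                      (sym (partialDivision-≮ x s c≮j))

-- This is one Horner step: column `suc j` gains `x` times column `j`, which already holds a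
-- coefficient of the quotient.
det-partialDivision-step : ∀ {N} (j : Fin N) x (s : Fin (suc N) → ℕ → ℤ) →
  det (suc N) (λ r c → partialDivision (suc (suc (toℕ j))) x (s r) (toℕ c)) ≡
  det (suc N) (λ r c → partialDivision (suc (toℕ j)) x (s r) (toℕ c))
det-partialDivision-step j x s = det-addColumn j x
  (λ r c c≢1+j → partialDivision-step x (s r) (c≢1+j ∘ toℕ-injective))
  (λ r → trans (partialDivision-< x (s r) ℕP.≤-refl)
    (trans (ℤP.+-comm (x * quotient (s r) x (toℕ j)) (s r (suc (toℕ j))))
      (cong₂ (λ a h → a + x * h)
        (sym (partialDivision-≮ x (s r) (ℕP.<-irrefl refl)))
        (sym (trans (cong (partialDivision (suc (toℕ j)) x (s r)) (toℕ-inject₁ j))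
                    (partialDivision-< x (s r) ℕP.≤-refl))))))

det-partialDivision : ∀ {N} j → j ℕ.≤ N → ∀ x (s : Fin N → ℕ → ℤ) →
  det N (λ r c → partialDivision j x (s r) (toℕ c)) ≡ det N (λ r c → s r (toℕ c))
det-partialDivision zero _ x s = det-cong (λ r c → partialDivision-≮ {zero} x (s r) λ ())
-- The first column needs no operation, as row and quotient have the same leading coefficient.
det-partialDivision {N} (suc zero) _ x s = det-cong (λ r c → first (s r) (toℕ c))
  where
  leading : ∀ x a → x * + 0 + a ≡ a
  leading = solve-∀

  first : ∀ t c → partialDivision 1 x t c ≡ t c
  first t zero    = leading x (t 0)
  first t (suc c) = partialDivision-≮ {1} x t λ { (s≤s ()) }
det-partialDivision (suc (suc i)) (s≤s i<N) x s =
  trans (subst (λ k → det _ (λ r c → partialDivision (suc (suc k)) x (s r) (toℕ c)) ≡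
                      det _ (λ r c → partialDivision (suc k) x (s r) (toℕ c)))
               (toℕ-fromℕ< i<N) (det-partialDivision-step (fromℕ< i<N) x s))
        (det-partialDivision (suc i) (ℕP.m≤n⇒m≤1+n i<N) x s)

-- Roots modulo a prime

∣0 : ∀ {d} → d ℤS.∣ + 0
∣0 = ℤS.divides (+ 0) refl

Distinct : ℕ → List ℤ → Set
Distinct q = AllPairs (λ x y → ¬ (+ q) ℤS.∣ (y - x))

∣*-cancelʳ : ∀ {q} → Prime q → ∀ a {b} → ¬ (+ q) ℤS.∣ b → (+ q) ℤS.∣ (a * b) → (+ q) ℤS.∣ a
∣*-cancelʳ {q} pq a {b} q∤b q∣ab
  with euclidsLemma ∣ a ∣ ∣ b ∣ pq (subst (q ℕD.∣_) (ℤP.abs-* a b) (ℤS.∣⇒∣ᵤ q∣ab))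
... | inj₁ q∣a = ℤS.∣ᵤ⇒∣ q∣a
... | inj₂ q∣b = contradiction (ℤS.∣ᵤ⇒∣ q∣b) q∤b

-- By `horner-quotient`, `q` divides the product of the quotient's value and `y - x`; primality
-- cancels `y - x`.
quotient-root : ∀ {q} → Prime q → ∀ s x {y} k → ¬ (+ q) ℤS.∣ (y - x) →
  (+ q) ℤS.∣ horner s x (suc k) → (+ q) ℤS.∣ horner s y (suc k) →
  (+ q) ℤS.∣ horner (quotient s x) y k
quotient-root {q} pq s x {y} k q∤y-x q∣sx q∣sy = ∣*-cancelʳ pq _ q∤y-x
  (subst ((+ q) ℤS.∣_) (sym (horner-quotient s x y k)) (ℤS.∣m∣n⇒∣m-n q∣sy q∣sx))

-- Lagrange's bound on the number of roots modulo a prime. Dividing by one root leaves a quotient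
-- with one coefficient fewer that vanishes at the other roots.
many-roots⇒∣coefficients : ∀ {q} → Prime q → ∀ k s xs → k ℕ.≤ length xs → Distinct q xs →
  All (λ x → (+ q) ℤS.∣ horner s x k) xs → ∀ c → c ℕ.< k → (+ q) ℤS.∣ s c
many-roots⇒∣coefficients {q} pq (suc k) s (x ∷ xs) (s≤s k≤) (x≉xs ∷ xs≉) (q∣sx ∷ q∣sxs) c (s≤s c≤k) =
  -- `s c` is `horner s x (suc c)` minus `x * horner s x c`, and `q` divides every partial Horner
  -- value.
  ℤS.∣m+n∣m⇒∣n (prefix (suc c) (s≤s c≤k)) (ℤS.∣n⇒∣m*n x (prefix c (ℕP.m≤n⇒m≤1+n c≤k)))
  where
  q∣quotient : ∀ c → c ℕ.< k → (+ q) ℤS.∣ quotient s x c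
  q∣quotient = many-roots⇒∣coefficients pq k (quotient s x) xs k≤ xs≉
    (All.zipWith (λ (q∤y-x , q∣sy) → quotient-root pq s x k q∤y-x q∣sx q∣sy) (x≉xs , q∣sxs))

  prefix : ∀ c → c ℕ.≤ suc k → (+ q) ℤS.∣ horner s x c
  prefix zero    _         = ∣0
  prefix (suc c) (s≤s c≤k) with ℕP.m≤n⇒m<n∨m≡n c≤k
  ... | inj₁ c<k  = q∣quotient c c<k
  ... | inj₂ refl = q∣sx

-- Only the first k columns are still to be divided; the remaining ones are arbitrary.
common-roots⇒^∣det : ∀ {q} → Prime q → ∀ {N} k → k ℕ.≤ N → (s : Fin N → ℕ → ℤ) →
  ∀ xs → length xs ℕ.≤ k → Distinct q xs →
  All (λ x → ∀ r → (+ q) ℤS.∣ horner (s r) x k) xs →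
  (+ (q ^ length xs)) ℤS.∣ det N (λ r c → s r (toℕ c))
common-roots⇒^∣det pq k k≤N s [] _ _ _ = ℤS.divides (det _ (λ r c → s r (toℕ c))) (sym (ℤP.*-identityʳ _))
common-roots⇒^∣det {q} pq {N} (suc k) k<N s (x ∷ xs) (s≤s xs≤k) (x≉xs ∷ xs≉) (q∣sx ∷ q∣sxs) =
  subst₂ ℤS._∣_ (sym (ℤP.pos-* q (q ^ length xs))) (sym det-s)
    (ℤS.*-monoʳ-∣ (+ q)
      (common-roots⇒^∣det pq k (ℕP.<⇒≤ k<N) s′ xs xs≤k xs≉
        (All.zipWith (λ (q∤y-x , q∣sy) r → roots r q∤y-x (q∣sy r)) (x≉xs , q∣sxs))))
  where
  -- Column `k` ends up holding the values at `x`; here they are divided by `q`, which takes one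
  -- factor `q` out of the determinant.
  s′ : Fin N → ℕ → ℤ
  s′ r c = if does (c ℕ.≟ k) then ℤS._∣_.quotient (q∣sx r) else partialDivision (suc k) x (s r) c

  s′-≢ : ∀ r {c} → c ≢ k → s′ r c ≡ partialDivision (suc k) x (s r) c
  s′-≢ r {c} c≢k rewrite dec-false (c ℕ.≟ k) c≢k = refl

  s′-k : ∀ r → s′ r k ≡ ℤS._∣_.quotient (q∣sx r)
  s′-k r rewrite dec-true (k ℕ.≟ k) refl = refl

  last : ∀ r → partialDivision (suc k) x (s r) k ≡ + q * s′ r k
  last r = trans (partialDivision-< x (s r) ℕP.≤-refl)
    (trans (ℤS._∣_.equality (q∣sx r))
      (trans (ℤP.*-comm _ (+ q)) (cong (+ q *_) (sym (s′-k r)))))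

  column : Fin N
  column = fromℕ< k<N

  det-s : det N (λ r c → s r (toℕ c)) ≡ + q * det N (λ r c → s′ r (toℕ c))
  det-s = trans (sym (det-partialDivision (suc k) k<N x s))
    (det-scale column (+ q)
      (λ r c c≢ → sym (s′-≢ r (λ e → c≢ (toℕ-injective (trans e (sym (toℕ-fromℕ< k<N)))))))
      (λ r → subst (λ c → partialDivision (suc k) x (s r) c ≡ + q * s′ r c)
                   (sym (toℕ-fromℕ< k<N)) (last r)))

  roots : ∀ r {y} → ¬ (+ q) ℤS.∣ (y - x) → (+ q) ℤS.∣ horner (s r) y (suc k) →
          (+ q) ℤS.∣ horner (s′ r) y k
  roots r {y} q∤y-x q∣sy = subst ((+ q) ℤS.∣_)
    (sym (horner-cong y k (λ c c<k →
      trans (s′-≢ r (ℕP.<⇒≢ c<k)) (partialDivision-< x (s r) (ℕP.m<n⇒m<1+n c<k)))))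
    (quotient-root pq (s r) x k q∤y-x (q∣sx r) q∣sy)

-- Rows of the Sylvester matrix as polynomials

coef-toℕ : ∀ n a (i : Fin (suc n)) → coef n a (toℕ i) ≡ a i
coef-toℕ n a i with toℕ i ℕ.<? suc n
... | yes i<1+n = cong a (fromℕ<-toℕ i i<1+n)
... | no  i≮1+n = contradiction (toℕ<n i) i≮1+n

shiftRow-< : ∀ n a {i c} → c ℕ.< i → shiftRow n a i c ≡ + 0
shiftRow-< n a {i} {c} c<i with i ℕ.≤? c
... | yes i≤c = contradiction c<i (ℕP.≤⇒≯ i≤c)
... | no  _   = refl

shiftRow-> : ∀ n a {i c} → i ℕ.+ suc n ℕ.≤ c → shiftRow n a i c ≡ + 0
shiftRow-> n a {i} {c} i+n<c with i ℕ.≤? c | c ℕ.∸ i ℕ.≤? n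
... | no  _ | _         = refl
... | yes _ | no  _     = refl
... | yes _ | yes c∸i≤n =
  contradiction (ℕP.m+n≤o⇒m≤o∸n (suc n) (subst (ℕ._≤ c) (ℕP.+-comm i (suc n)) i+n<c)) (ℕP.≤⇒≯ c∸i≤n)

shiftRow-+ : ∀ n a i c → shiftRow n a i (i ℕ.+ c) ≡ shiftRow n a 0 c
shiftRow-+ n a i c rewrite ℕP.m+n∸m≡n i c with i ℕ.≤? i ℕ.+ c
... | yes _   = refl
... | no  i≰ = contradiction (ℕP.m≤m+n i c) i≰

shiftRow-coefficient : ∀ n a (i : Fin (suc n)) → shiftRow n a 0 (n ℕ.∸ toℕ i) ≡ a i
shiftRow-coefficient n a i with n ℕ.∸ toℕ i ℕ.≤? n
... | yes _ = trans (cong (coef n a) (ℕP.m∸[m∸n]≡n (toℕ≤pred[n] i))) (coef-toℕ n a i)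
... | no n∸i≰n = contradiction (ℕP.m∸n≤m n (toℕ i)) n∸i≰n

horner-shiftRow-0 : ∀ n a x → horner (shiftRow n a 0) x (suc n) ≡ eval n a x
horner-shiftRow-0 n a x = trans (horner-Σ (shiftRow n a 0) x n)
  (Σ-cong {suc n} (λ i → cong (_* (x ℤ.^ toℕ i)) (shiftRow-coefficient n a i)))

horner-zero : ∀ {s} x k → (∀ c → c ℕ.< k → s c ≡ + 0) → horner s x k ≡ + 0
horner-zero x zero    s≗0 = refl
horner-zero x (suc k) s≗0 =
  trans (cong₂ (λ h a → x * h + a) (horner-zero x k (λ c c<k → s≗0 c (ℕP.m<n⇒m<1+n c<k))) (s≗0 k ℕP.≤-refl))
        (trans (ℤP.+-identityʳ _) (ℤP.*-zeroʳ x))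

-- The `i` leading zeros keep the Horner value at zero, so the scheme starts afresh at column `i`.
horner-shiftRow : ∀ n a i x k → horner (shiftRow n a i) x (i ℕ.+ k) ≡ horner (shiftRow n a 0) x k
horner-shiftRow n a i x zero =
  trans (cong (horner (shiftRow n a i) x) (ℕP.+-identityʳ i))
        (horner-zero x i (λ c → shiftRow-< n a))
horner-shiftRow n a i x (suc k) =
  trans (cong (horner (shiftRow n a i) x) (ℕP.+-suc i k))
        (cong₂ (λ h b → x * h + b) (horner-shiftRow n a i x k) (shiftRow-+ n a i k))

-- Each trailing zero only multiplies the value by `x`.
∣horner-pad : ∀ {d s} x k e → (∀ c → k ℕ.≤ c → s c ≡ + 0) →
  d ℤS.∣ horner s x k → d ℤS.∣ horner s x (k ℕ.+ e)
∣horner-pad {d} {s} x k zero    s≗0 d∣ = subst (λ l → d ℤS.∣ horner s x l) (sym (ℕP.+-identityʳ k)) d∣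
∣horner-pad {d} {s} x k (suc e) s≗0 d∣ =
  subst (λ l → d ℤS.∣ horner s x l) (sym (ℕP.+-suc k e))
    (ℤS.∣m∣n⇒∣m+n (ℤS.∣n⇒∣m*n x (∣horner-pad x k e s≗0 d∣))
      (subst (d ℤS.∣_) (sym (s≗0 (k ℕ.+ e) (ℕP.m≤m+n k e))) ∣0))

-- The row has `i` leading zeros, `n + 1` coefficients and `m - 1 - i` trailing zeros, so it
-- represents the polynomial times the power `m - 1 - i` of the variable.
∣horner-shiftRow : ∀ {d} n a x {i m} → i ℕ.< m → d ℤS.∣ eval n a x →
  d ℤS.∣ horner (shiftRow n a i) x (n ℕ.+ m)
∣horner-shiftRow {d} n a x {i} {m} i<m d∣ax =
  subst (λ l → d ℤS.∣ horner (shiftRow n a i) x l) length-eq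
    (∣horner-pad x (i ℕ.+ suc n) (m ℕ.∸ suc i) (λ c → shiftRow-> n a)
      (subst (d ℤS.∣_)
        (sym (trans (horner-shiftRow n a i x (suc n)) (horner-shiftRow-0 n a x))) d∣ax))
  where
  open ≡-Reasoning
  length-eq : i ℕ.+ suc n ℕ.+ (m ℕ.∸ suc i) ≡ n ℕ.+ m
  length-eq = begin
    i ℕ.+ suc n ℕ.+ (m ℕ.∸ suc i)   ≡⟨ cong (ℕ._+ (m ℕ.∸ suc i)) (trans (ℕP.+-suc i n) (ℕP.+-comm (suc i) n)) ⟩
    n ℕ.+ suc i ℕ.+ (m ℕ.∸ suc i)   ≡⟨ ℕP.+-assoc n (suc i) _ ⟩
    n ℕ.+ (suc i ℕ.+ (m ℕ.∸ suc i)) ≡⟨ cong (n ℕ.+_) (ℕP.m+[n∸m]≡n i<m) ⟩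
    n ℕ.+ m                         ∎

-- Columns are indexed by all naturals, since `horner` reads a row as a sequence.
sylvesterRow : ∀ n (a : Fin (suc n) → ℤ) m (b : Fin (suc m) → ℤ) → Fin (n ℕ.+ m) → ℕ → ℤ
sylvesterRow n a m b r with toℕ r ℕ.<? m
... | yes _ = shiftRow n a (toℕ r)
... | no  _ = shiftRow m b (toℕ r ℕ.∸ m)

sylvester-row : ∀ n a m b r c → sylvester n a m b r c ≡ sylvesterRow n a m b r (toℕ c)
sylvester-row n a m b r c with toℕ r ℕ.<? m
... | yes _ = refl
... | no  _ = refl

∣horner-sylvesterRow : ∀ {d} n a m b x → d ℤS.∣ eval n a x → d ℤS.∣ eval m b x →
  ∀ r → d ℤS.∣ horner (sylvesterRow n a m b r) x (n ℕ.+ m)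
∣horner-sylvesterRow {d} n a m b x d∣ax d∣bx r with toℕ r ℕ.<? m
... | yes r<m = ∣horner-shiftRow n a x r<m d∣ax
... | no  r≮m = subst (λ l → d ℤS.∣ horner (shiftRow m b (toℕ r ℕ.∸ m)) x l) (ℕP.+-comm m n)
  (∣horner-shiftRow m b x
    (ℕP.m<n+o⇒m∸n<o (toℕ r) m ⦃ n≢0 ⦄ (subst (toℕ r ℕ.<_) (ℕP.+-comm n m) (toℕ<n r))) d∣bx)
  where
  -- For `n = 0` every row index would be below `m`.
  n≢0 : ℕ.NonZero n
  n≢0 = ℕ.≢-nonZero λ { refl → r≮m (toℕ<n r) }

-- Counting common roots

-- The difference of two distinct residues, larger minus smaller, is positive and below `q`.
upTo-distinct : ∀ q → AllPairs (λ x y → ¬ (+ q) ℤS.∣ (+ y - + x)) (upTo q)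
upTo-distinct q = AllPairsP.applyUpTo⁺₁ (λ i → i) q distinct
  where
  distinct : ∀ {i j} → i ℕ.< j → j ℕ.< q → ¬ (+ q) ℤS.∣ (+ j - + i)
  distinct {i} {j} i<j j<q q∣j-i = ℕD.>⇒∤ ⦃ ℕ.>-nonZero (ℕP.m<n⇒0<n∸m i<j) ⦄
    (ℕP.≤-<-trans (ℕP.m∸n≤m j i) j<q)
    (ℤS.∣⇒∣ᵤ (subst ((+ q) ℤS.∣_) (trans (ℤP.m-n≡m⊖n j i) (ℤP.⊖-≥ (ℕP.<⇒≤ i<j))) q∣j-i))

theorem1 : (q : ℕ) → Prime q →
    (n : ℕ) (a : Fin (suc n) → ℤ) → a (fromℕ n) ≢ + 0 →
    (m : ℕ) (b : Fin (suc m) → ℤ) → b (fromℕ m) ≢ + 0 →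
    ∃ (λ i → ¬ ((+ q) ∣ a i)) →
    ∃ (λ j → ¬ ((+ q) ∣ b j)) →
    (ℓ : ℕ) → commonRootCount q n a m b ≡ ℓ →
    (+ (q ^ ℓ)) ∣ resultant n a m b
theorem1 q pq n a _ m b _ (i , q∤aᵢ) _ ℓ refl =
  ℤS.∣⇒∣ᵤ (subst₂ (λ l d → (+ (q ^ l)) ℤS.∣ d) (length-map +_ solutions)
    (det-cong (λ r c → sym (sylvester-row n a m b r c)))
    (common-roots⇒^∣det pq (n ℕ.+ m) ℕP.≤-refl (sylvesterRow n a m b) roots
      (ℕP.≤-trans roots≤n (ℕP.m≤m+n n m)) roots-distinct
      (All.map (λ {x} (q∣ax , q∣bx) → ∣horner-sylvesterRow n a m b x q∣ax q∣bx) q∣roots)))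
  where
  -- The same test as in `commonRootCount`, so `ℓ` is `length solutions` by definition.
  common? = λ x → (q ℕD.∣? ∣ eval n a (+ x) ∣) ×-dec (q ℕD.∣? ∣ eval m b (+ x) ∣)

  solutions : List ℕ
  solutions = filter common? (upTo q)

  roots : List ℤ
  roots = map +_ solutions

  roots-distinct : Distinct q roots
  roots-distinct = AllPairsP.map⁺ (AllPairsP.filter⁺ common? (upTo-distinct q))

  q∣roots : All (λ x → (+ q) ℤS.∣ eval n a x × (+ q) ℤS.∣ eval m b x) roots
  q∣roots = AllP.map⁺ (All.map (λ (q∣ax , q∣bx) → ℤS.∣ᵤ⇒∣ q∣ax , ℤS.∣ᵤ⇒∣ q∣bx)
                               (AllP.all-filter common? (upTo q)))

  -- With more than `n` roots, `q` would divide every coefficient, including `a i`, which stands in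
  -- column `n - i` of the unshifted row.
  roots≤n : length roots ℕ.≤ n
  roots≤n = ℕP.≮⇒≥ λ n<roots → q∤aᵢ (ℤS.∣⇒∣ᵤ (subst ((+ q) ℤS.∣_) (shiftRow-coefficient n a i)
    (many-roots⇒∣coefficients pq (suc n) (shiftRow n a 0) roots n<roots roots-distinct
      (All.map (λ {x} (q∣ax , _) → subst ((+ q) ℤS.∣_) (sym (horner-shiftRow-0 n a x)) q∣ax) q∣roots)
      (n ℕ.∸ toℕ i) (s≤s (ℕP.m∸n≤m n (toℕ i))))))
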